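{- For every loopless signed graph $G$ with underlying unsigned graph $\underline{G}$ one has $\chi(G)\le 2\chi(\underline{G})-1$, where $\chi(G)$ is the chromatic number of the signed graph $G$ and $\chi(\underline{G})$ is the usual chromatic number of $\underline{G}$. Furthermore, this bound is sharp: for every integer $n\ge 1$ there exists a loopless signed graph $G$ with $\chi(\underline{G})=n$ and $\chi(G)=2n-1$.
   Context: All graphs are finite and nonempty. A signed graph $G$ is a graph (parallel edges allowed) in which each edge $e$ is labelled with a sign $\sigma(e)\in\{+1,-1\}$; its underlying unsigned graph, obtained by forgetting the signs, is denoted by $\underline{G}$. A proper colouring of $G$ is a mapping $\phi\colon V(G)\to\mathbb{Z}$ such that for each edge $e=uv$ of $G$ we have $\phi(u)\neq\sigma(e)\phi(v)$. For $n\ge1$ let $M_n=\{\pm1,\pm2,\ldots,\pm k\}$ if $n=2k$, and $M_n=\{0,\pm1,\pm2,\ldots,\pm k\}$ if $n=2k+1$. An $n$-colouring of $G$ is a proper colouring of $G$ using colours from $M_n$. The chromatic number $\chi(G)$ of a signed graph $G$ is the smallest $n\ge 1$ such that $G$ admits an $n$-colouring. -}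

module Defs where

open import Data.Fin using (Fin; toℕ; finToFun; funToFin)
import Data.Fin.Properties as Fin
open import Data.Integer as ℤ using (ℤ; +_; -[1+_]; ∣_∣; _◃_)
import Data.Integer.Properties as ℤ
open import Data.List using (List; map; upTo; allFin; _++_; lookup; length)
open import Data.List.Membership.Propositional using (_∈_)
open import Data.List.Membership.Propositional.Properties
  using (∈-map⁺; ∈-++⁺ˡ; ∈-++⁺ʳ; ∈-upTo⁺; ∈-allFin)
open import Data.List.Relation.Unary.Any using (index)
open import Data.List.Relation.Unary.Any.Properties using (lookup-index)
open import Data.Nat using (ℕ; zero; suc; _+_; _*_; _≤_; s≤s; z≤n; NonZero; _≟_; _≤?_; >-nonZero⁻¹)
import Data.Nat.Properties as ℕ
open import Data.Product using (∃; ∃-syntax; _×_; _,_; proj₁; proj₂)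
open import Data.Sign as Sign using (Sign)
open import Data.Sum using (_⊎_; inj₁; inj₂)
open import Function using (_∘_)
open import Relation.Binary.PropositionalEquality
  using (_≡_; _≢_; _≗_; refl; sym; trans; cong; subst)
open import Relation.Nullary using (Dec; yes; no; contradiction)
open import Relation.Nullary.Decidable using (map′; ¬?; _×-dec_; _⊎-dec_)
open import Relation.Unary using (Pred; Decidable)
open import Level using (0ℓ)

-- Finite nonempty graphs; loops and parallel edges are allowed.  Edges are
-- undirected: the order of the pair `ends e` is an artefact of the encoding
-- and every notion below is invariant under swapping it.
record Graph : Set where
  field
    order        : ℕ
    ⦃ nonempty ⦄ : NonZero order
    size         : ℕ
    ends         : Fin size → Fin order × Fin order

  Vertex : Set
  Vertex = Fin order

  Edge : Set
  Edge = Fin size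

  end₁ end₂ : Edge → Vertex
  end₁ = proj₁ ∘ ends
  end₂ = proj₂ ∘ ends

record SignedGraph : Set where
  field
    underlying : Graph
    σ          : Graph.Edge underlying → Sign

  open Graph underlying public

open SignedGraph public using (underlying)

Loopless : Graph → Set
Loopless G = ∀ e → end₁ e ≢ end₂ e
  where open Graph G

IsLeast : Pred ℕ 0ℓ → ℕ → Set
IsLeast P n = P n × (∀ m → P m → n ≤ m)

module _ (G : Graph) where
  open Graph G

  IsColouring : (n : ℕ) → (Vertex → Fin n) → Set
  IsColouring n φ = ∀ e → φ (end₁ e) ≢ φ (end₂ e)

  Colourable : Pred ℕ 0ℓ
  Colourable n = ∃[ φ ] IsColouring n φ

-- {±1, …, ±k} if n = 2k, and {0, ±1, …, ±k} if n = 2k + 1.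
M : ℕ → Pred ℤ 0ℓ
M n c = (∃[ k ] n ≡ 2 * k × 1 ≤ ∣ c ∣ × ∣ c ∣ ≤ k)
      ⊎ (∃[ k ] n ≡ 2 * k + 1 × ∣ c ∣ ≤ k)

module _ (G : SignedGraph) where
  open SignedGraph G

  -- `σ e ◃ 1` is the sign of e as an integer, +1 or -1.
  IsProper : (Vertex → ℤ) → Set
  IsProper φ = ∀ e → φ (end₁ e) ≢ (σ e ◃ 1) ℤ.* φ (end₂ e)

  IsSignedColouring : ℕ → (Vertex → ℤ) → Set
  IsSignedColouring n φ = IsProper φ × (∀ v → M n (φ v))

  SignedColourable : Pred ℕ 0ℓ
  SignedColourable n = 1 ≤ n × ∃[ φ ] IsSignedColouring n φ

least : {P : Pred ℕ 0ℓ} → Decidable P → ∃ P → ∃ (IsLeast P)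
least {P} P? (N , pN) with search (suc N)
  where
  search : ∀ b → ∃ (IsLeast P) ⊎ (∀ m → P m → b ≤ m)
  search zero = inj₂ λ _ _ → z≤n
  search (suc b) with search b
  ... | inj₁ found = inj₁ found
  ... | inj₂ lower with P? b
  ...   | yes pb = inj₁ (b , pb , lower)
  ...   | no ¬pb = inj₂ λ m pm →
            ℕ.≤∧≢⇒< (lower m pm) λ { refl → ¬pb pm }
... | inj₁ found = found
... | inj₂ lower = contradiction (lower N pN) (ℕ.<-irrefl refl)

anyFunction? : ∀ {A : Set} {k} {P : Pred (Fin k → A) 0ℓ} (xs : List A) →
               Decidable P →
               (∀ {f g} → f ≗ g → P f → P g) →
               (∀ f → P f → ∀ i → f i ∈ xs) →
               Dec (∃ P)
anyFunction? {A} {k} {P} xs P? resp range =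
  map′ (λ (c , p) → decode c , p) encode (Fin.any? (P? ∘ decode))
  where
  decode : _ → Fin k → A
  decode c i = lookup xs (finToFun c i)

  encode : ∃ P → ∃ (P ∘ decode)
  encode (f , p) = funToFin g , resp f≗ p
    where
    g : Fin k → Fin (length xs)
    g i = index (range f p i)

    f≗ : f ≗ decode (funToFin g)
    f≗ i = trans (lookup-index (range f p i))
                 (cong (lookup xs) (sym (Fin.finToFun-funToFin g i)))

colourable? : ∀ G → Decidable (Colourable G)
colourable? G n = anyFunction? (allFin n)
  (λ φ → Fin.all? λ e → ¬? (φ (end₁ e) Fin.≟ φ (end₂ e)))
  (λ f≗g p e q → p e (trans (f≗g _) (trans q (sym (f≗g _)))))
  (λ f _ i → ∈-allFin (f i))
  where open Graph G

M? : ∀ n → Decidable (M n)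
M? n c = half? (λ k → n ≟ 2 * k ×-dec (1 ≤? ∣ c ∣ ×-dec ∣ c ∣ ≤? k))
               (λ { k (refl , _) → ℕ.m≤m+n k _ })
   ⊎-dec half? (λ k → n ≟ 2 * k + 1 ×-dec ∣ c ∣ ≤? k)
               (λ { k (refl , _) → ℕ.≤-trans (ℕ.m≤m+n k _) (ℕ.m≤m+n _ 1) })
  where
  half? : {Q : Pred ℕ 0ℓ} → Decidable Q → (∀ k → Q k → k ≤ n) → Dec (∃ Q)
  half? Q? bound = map′ (λ (k , _ , q) → k , q)
                        (λ (k , q) → k , s≤s (bound k q) , q)
                        (ℕ.anyUpTo? Q? (suc n))

M-bounded : ∀ n c → M n c → ∣ c ∣ ≤ n
M-bounded _ c (inj₁ (k , refl , _ , c≤k)) = ℕ.≤-trans c≤k (ℕ.m≤m+n k _)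
M-bounded _ c (inj₂ (k , refl , c≤k)) =
  ℕ.≤-trans c≤k (ℕ.≤-trans (ℕ.m≤m+n k _) (ℕ.m≤m+n _ 1))

signedColourable? : ∀ G → Decidable (SignedColourable G)
signedColourable? G n = 1 ≤? n ×-dec anyFunction? interval
  (λ φ → Fin.all? (λ e → ¬? (φ (end₁ e) ℤ.≟ (σ e ◃ 1) ℤ.* φ (end₂ e)))
         ×-dec Fin.all? (λ v → M? n (φ v)))
  (λ f≗g (p , m) →
    (λ e q → p e (trans (f≗g _)
                   (trans q (cong ((σ e ◃ 1) ℤ.*_) (sym (f≗g _)))))) ,
    (λ v → subst (M n) (f≗g v) (m v)))
  (λ f (_ , m) v → ∈-interval (f v) (M-bounded n (f v) (m v)))
  where
  open SignedGraph G

  interval : List ℤ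
  interval = map +_ (upTo (suc n)) ++ map -[1+_] (upTo n)

  ∈-interval : ∀ c → ∣ c ∣ ≤ n → c ∈ interval
  ∈-interval (+ a)    a≤n = ∈-++⁺ˡ (∈-map⁺ +_ (∈-upTo⁺ (s≤s a≤n)))
  ∈-interval -[1+ a ] a<n =
    ∈-++⁺ʳ (map +_ (upTo (suc n))) (∈-map⁺ -[1+_] (∈-upTo⁺ a<n))

colourable : ∀ G → Loopless G → ∃ (Colourable G)
colourable G ll = Graph.order G , (λ v → v) , ll

signedColourable : ∀ G → Loopless (underlying G) → ∃ (SignedColourable G)
signedColourable G ll =
  2 * order , ℕ.≤-trans (>-nonZero⁻¹ order) (ℕ.m≤m+n order _) ,
  φ , proper , λ v → inj₁ (order , refl , s≤s z≤n , Fin.toℕ<n v)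
  where
  open SignedGraph G

  φ : Vertex → ℤ
  φ v = + suc (toℕ v)

  distinct : ∀ s {u v} → u ≢ v → φ u ≢ (s ◃ 1) ℤ.* φ v
  distinct Sign.+ u≢v eq = u≢v (Fin.toℕ-injective
    (ℕ.suc-injective (ℤ.+-injective (trans eq (ℤ.*-identityˡ _)))))
  distinct Sign.- u≢v ()

  proper : IsProper G φ
  proper e = distinct (σ e) (ll e)

-- Only the least-element specification of the chromatic numbers matters,
-- so the search computing them is kept from unfolding.
abstract
  χ-exists : ∀ G → Loopless G → ∃ (IsLeast (Colourable G))
  χ-exists G ll = least (colourable? G) (colourable G ll)

  signedχ-exists : ∀ G → Loopless (underlying G) →
                   ∃ (IsLeast (SignedColourable G))
  signedχ-exists G ll = least (signedColourable? G) (signedColourable G ll)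

χ : ∀ G → Loopless G → ℕ
χ G ll = proj₁ (χ-exists G ll)

χ-isLeast : ∀ G ll → IsLeast (Colourable G) (χ G ll)
χ-isLeast G ll = proj₂ (χ-exists G ll)

signedχ : ∀ G → Loopless (underlying G) → ℕ
signedχ G ll = proj₁ (signedχ-exists G ll)

signedχ-isLeast : ∀ G ll → IsLeast (SignedColourable G) (signedχ G ll)
signedχ-isLeast G ll = proj₂ (signedχ-exists G ll)

{-# OPTIONS --safe #-}
-- Colouring with 0, …, k − 1 a graph that is k-colourable without signs uses
-- only colours of M (2k − 1), and distinct nonnegative colours are never
-- negatives of each other.  Equality holds for the complete graph with every
-- edge present in both signs: there the absolute values of the colours are
-- distinct, and M (2n − 2) offers only n − 1 of them.
module Submission where

open import Defs
open import Data.Fin as Fin using (Fin; toℕ; fromℕ<; punchIn; punchOut; remQuot; combine)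
import Data.Fin.Properties as Fin
open import Data.Integer as ℤ using (ℤ; +_; -[1+_]; ∣_∣; _◃_)
import Data.Integer.Properties as ℤ
open import Data.Nat using (ℕ; zero; suc; _+_; _≤_; _<_; _*_; _∸_; s≤s; s≤s⁻¹; pred; >-nonZero; >-nonZero⁻¹)
import Data.Nat.Properties as ℕ
open import Data.Product using (∃-syntax; _×_; _,_; proj₁; proj₂; Σ-syntax)
open import Data.Sign as Sign using (Sign)
open import Data.Sum using (inj₁; inj₂)
open import Function using (_∘_; id)
open import Function.Definitions using (Injective)
open import Relation.Binary.PropositionalEquality
  using (_≡_; _≢_; refl; sym; trans; cong; subst)
open import Relation.Nullary using (yes; no; contradiction)

-- The search behind `χ` and `signedχ` is abstract, so their values can only be pinned down by
-- uniqueness of least elements.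
IsLeast-≡ : ∀ {P m n} → IsLeast P m → IsLeast P n → m ≡ n
IsLeast-≡ (pm , m≤) (pn , n≤) = ℕ.≤-antisym (m≤ _ pn) (n≤ _ pm)

∣◃1*∣ : ∀ s c → ∣ (s ◃ 1) ℤ.* c ∣ ≡ ∣ c ∣
∣◃1*∣ s c = trans (ℤ.abs-* (s ◃ 1) c)
  (trans (cong (_* ∣ c ∣) (ℤ.abs-◃ s 1)) (ℕ.*-identityˡ ∣ c ∣))

∣∣-≡⇒◃1* : ∀ a b → ∣ a ∣ ≡ ∣ b ∣ → ∃[ s ] a ≡ (s ◃ 1) ℤ.* b
∣∣-≡⇒◃1* (+ _)    (+ _)    refl = Sign.+ , sym (ℤ.*-identityˡ _)
∣∣-≡⇒◃1* (+ _)    -[1+ n ] refl = Sign.- , sym (ℤ.-1*i≡-i -[1+ n ])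
∣∣-≡⇒◃1* -[1+ n ] (+ _)    refl = Sign.- , sym (ℤ.-1*i≡-i (+ suc n))
∣∣-≡⇒◃1* -[1+ _ ] -[1+ _ ] refl = Sign.+ , sym (ℤ.*-identityˡ _)

2*suc∸1 : ∀ k → 2 * suc k ∸ 1 ≡ 2 * k + 1
2*suc∸1 k = trans (ℕ.+-suc k (k + 0)) (ℕ.+-comm 1 (2 * k))

2*k≢2*l+1 : ∀ k l → 2 * k ≢ 2 * l + 1
2*k≢2*l+1 k l eq = ℕ.even≢odd k l (trans eq (ℕ.+-comm (2 * l) 1))

-- Parity refutes the second disjunct of `M`, and cancelling the factor 2 identifies the witness of
-- the first with `k`.
M-even : ∀ k c → M (2 * k) c → 1 ≤ ∣ c ∣ × ∣ c ∣ ≤ k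
M-even k c (inj₁ (l , eq , 1≤c , c≤l)) =
  1≤c , subst (∣ c ∣ ≤_) (sym (ℕ.*-cancelˡ-≡ k l 2 eq)) c≤l
M-even k c (inj₂ (l , eq , _)) = contradiction eq (2*k≢2*l+1 k l)

M-odd : ∀ k c → M (2 * k + 1) c → ∣ c ∣ ≤ k
M-odd k c (inj₁ (l , eq , _)) = contradiction (sym eq) (2*k≢2*l+1 l k)
M-odd k c (inj₂ (l , eq , c≤l)) =
  subst (∣ c ∣ ≤_)
    (sym (ℕ.*-cancelˡ-≡ k l 2 (ℕ.+-cancelʳ-≡ 1 (2 * k) (2 * l) eq))) c≤l

bounded-injective⇒≤ : ∀ {n k} (f : Fin n → ℕ) → Injective _≡_ _≡_ f →
                      (∀ i → f i < k) → n ≤ k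
bounded-injective⇒≤ f inj f<k =
  Fin.injective⇒≤ {f = λ i → fromℕ< (f<k i)} λ {i} {j} eq →
    inj (Fin.fromℕ<-injective (f i) (f j) (f<k i) (f<k j) eq)

-- Pigeonhole on absolute values: `M n` offers `k` of them if `n = 2 * k`, and `k + 1` if
-- `n = 2 * k + 1`.
distinct-abs⇒≤ : ∀ {m n} (φ : Fin (suc m) → ℤ) → Injective _≡_ _≡_ (∣_∣ ∘ φ) →
                 (∀ v → M n (φ v)) → 2 * suc m ∸ 1 ≤ n
-- Any one vertex reveals the parity of `n`.
distinct-abs⇒≤ {m} φ inj inM with inM Fin.zero
... | inj₁ (k , refl , _) =
  -- The colour 0 is absent here, so `pred` moves the absolute values into `0, …, k − 1`. This
  -- yields `2 * suc m ≤ n`, one better than required.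
  ℕ.≤-trans (ℕ.m∸n≤m (2 * suc m) 1) (ℕ.*-monoʳ-≤ 2
    (bounded-injective⇒≤ (pred ∘ ∣_∣ ∘ φ) pred-inj pred<k))
  where
  pred-suc : ∀ v → suc (pred ∣ φ v ∣) ≡ ∣ φ v ∣
  pred-suc v = ℕ.suc-pred ∣ φ v ∣ ⦃ >-nonZero (proj₁ (M-even k (φ v) (inM v))) ⦄

  pred-inj : Injective _≡_ _≡_ (pred ∘ ∣_∣ ∘ φ)
  pred-inj {u} {v} eq = inj (trans (sym (pred-suc u)) (trans (cong suc eq) (pred-suc v)))

  pred<k : ∀ v → pred ∣ φ v ∣ < k
  pred<k v = subst (_≤ k) (sym (pred-suc v)) (proj₂ (M-even k (φ v) (inM v)))
... | inj₂ (k , refl , _) = subst (_≤ 2 * k + 1) (sym (2*suc∸1 m))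
  (ℕ.+-monoˡ-≤ 1 (ℕ.*-monoʳ-≤ 2 (s≤s⁻¹
    (bounded-injective⇒≤ (∣_∣ ∘ φ) inj λ v → s≤s (M-odd k (φ v) (inM v))))))

Colourable⇒SignedColourable : ∀ G {k} → Colourable (underlying G) k →
                              SignedColourable G (2 * k ∸ 1)
-- Truncated subtraction would give 0 colours here, but a graph has a vertex and `Fin 0` is empty.
Colourable⇒SignedColourable G {zero} (φ , _)
  with () ← φ (fromℕ< (>-nonZero⁻¹ (SignedGraph.order G)))
Colourable⇒SignedColourable G {suc k} (φ , proper) =
  subst (1 ≤_) (sym (2*suc∸1 k)) (ℕ.m≤n+m 1 (2 * k)) ,
  (λ v → + toℕ (φ v)) ,
  -- Absolute values erase the sign of the edge, so a signed conflict would be an unsigned one.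
  (λ e eq → proper e (Fin.toℕ-injective
    (trans (cong ∣_∣ eq) (∣◃1*∣ (σ e) (+ toℕ (φ (end₂ e))))))) ,
  λ v → inj₂ (k , 2*suc∸1 k , s≤s⁻¹ (Fin.toℕ<n (φ v)))
  where open SignedGraph G

signedχ≤2χ∸1 : (G : SignedGraph) (ll : Loopless (underlying G)) →
               signedχ G ll ≤ 2 * χ (underlying G) ll ∸ 1
signedχ≤2χ∸1 G ll = proj₂ (signedχ-isLeast G ll) _
  (Colourable⇒SignedColourable G (proj₁ (χ-isLeast (underlying G) ll)))

sign : Fin 2 → Sign
sign Fin.zero    = Sign.+
sign (Fin.suc _) = Sign.-

sign⁻¹ : Sign → Fin 2
sign⁻¹ Sign.+ = Fin.zero
sign⁻¹ Sign.- = Fin.suc Fin.zero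

sign-sign⁻¹ : ∀ s → sign (sign⁻¹ s) ≡ s
sign-sign⁻¹ Sign.+ = refl
sign-sign⁻¹ Sign.- = refl

-- Since `punchIn i` skips `i`, every ordered pair of distinct vertices is hit exactly once and no
-- loop arises.
distinctPair : ∀ {m} → Fin (suc m) × Fin m → Fin (suc m) × Fin (suc m)
distinctPair (i , j) = i , punchIn i j

-- For each sign and every ordered pair of distinct vertices there is an edge,
-- so any two vertices are joined by two parallel edges of each sign.
±K : ℕ → SignedGraph
±K m = record
  { underlying = record
    { order = suc m
    ; size  = 2 * (suc m * m)
    ; ends  = distinctPair ∘ remQuot m ∘ proj₂ ∘ remQuot {2} (suc m * m)
    }
  ; σ = sign ∘ proj₁ ∘ remQuot {2} (suc m * m)
  }

module _ (m : ℕ) where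
  open SignedGraph (±K m)

  ±K-loopless : Loopless (underlying (±K m))
  ±K-loopless e = Fin.punchInᵢ≢i _ _ ∘ sym

  -- `combine` and `punchOut` invert the `remQuot` and `punchIn` that decode an edge.
  ±K-edge : ∀ s {u v} → u ≢ v → ∃[ e ] ends e ≡ (u , v) × σ e ≡ s
  ±K-edge s {u} {v} u≢v = combine (sign⁻¹ s) p , ends≡ , σ≡
    where
    p : Fin (suc m * m)
    p = combine u (punchOut u≢v)

    ends≡ : ends (combine (sign⁻¹ s) p) ≡ (u , v)
    ends≡ = trans
      (cong (distinctPair ∘ remQuot m ∘ proj₂) (Fin.remQuot-combine (sign⁻¹ s) p))
      (trans (cong distinctPair (Fin.remQuot-combine u (punchOut u≢v)))
             (cong (u ,_) (Fin.punchIn-punchOut u≢v)))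

    σ≡ : σ (combine (sign⁻¹ s) p) ≡ s
    σ≡ = trans (cong (sign ∘ proj₁) (Fin.remQuot-combine (sign⁻¹ s) p))
               (sign-sign⁻¹ s)

  ±K-colouring-injective : ∀ {k φ} → IsColouring (underlying (±K m)) k φ →
                           Injective _≡_ _≡_ φ
  ±K-colouring-injective proper {u} {v} eq with u Fin.≟ v
  ... | yes u≡v = u≡v
  ... | no u≢v with e , refl , _ ← ±K-edge Sign.+ u≢v = contradiction eq (proper e)

  -- Equal absolute values differ by some sign `s`, and the edge of sign `s` joining the two
  -- vertices is then in conflict.
  ±K-proper-∣∣-injective : ∀ {φ} → IsProper (±K m) φ → Injective _≡_ _≡_ (∣_∣ ∘ φ)
  ±K-proper-∣∣-injective {φ} proper {u} {v} eq with u Fin.≟ v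
  ... | yes u≡v = u≡v
  ... | no u≢v with s , φu≡sφv ← ∣∣-≡⇒◃1* (φ u) (φ v) eq
               with e , refl , refl ← ±K-edge s u≢v = contradiction φu≡sφv (proper e)

  ±K-χ : IsLeast (Colourable (underlying (±K m))) (suc m)
  ±K-χ = (id , ±K-loopless) , λ k (φ , proper) →
    Fin.injective⇒≤ (±K-colouring-injective {φ = φ} proper)

  ±K-signedχ : IsLeast (SignedColourable (±K m)) (2 * suc m ∸ 1)
  ±K-signedχ = Colourable⇒SignedColourable (±K m) (proj₁ ±K-χ) ,
    λ n (_ , φ , proper , inM) →
      distinct-abs⇒≤ φ (±K-proper-∣∣-injective {φ} proper) inM

theorem2p1 : ((G : SignedGraph) (ll : Loopless (underlying G)) →
    signedχ G ll ≤ 2 * χ (underlying G) ll ∸ 1)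
    ×
    ((n : ℕ) → 1 ≤ n →
    Σ[ G ∈ SignedGraph ] Σ[ ll ∈ Loopless (underlying G) ]
    (χ (underlying G) ll ≡ n × signedχ G ll ≡ 2 * n ∸ 1))
theorem2p1 = signedχ≤2χ∸1 , λ { (suc m) _ →
  ±K m , ±K-loopless m ,
  IsLeast-≡ (χ-isLeast (underlying (±K m)) (±K-loopless m)) (±K-χ m) ,
  IsLeast-≡ (signedχ-isLeast (±K m) (±K-loopless m)) (±K-signedχ m) }
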